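{- Let $H$ be the complement of the cycle on seven vertices, i.e. the graph with vertex set $\mathbb Z_7$ in which $u,v$ are adjacent exactly when their cyclic distance is two or three. Then $$\mathrm{lrw}(H)=2\qquad\text{and}\qquad \mathrm{anw}(H)=3,$$ and $H$ has no pair of false twins or true twins.
   Context: All graphs are finite, simple and undirected. Two distinct vertices $u,v$ of a graph are false twins if $N(u)=N(v)$, and true twins if $N[u]=N[v]$, where $N$ and $N[\cdot]$ denote open and closed neighborhoods. For a graph $G$, a layout is a linear order $\pi=(v_1,\dots,v_n)$ of $V(G)$; put $P_i=\{v_1,\dots,v_i\}$ for $0\le i\le n$. Linear rank-width: for $X\subseteq V(G)$ the cutrank $\rho_G(X)$ is the rank over $\mathbb F_2$ of the $X\times (V(G)\setminus X)$ adjacency matrix, and $\mathrm{lrw}(G)=\min_\pi\max_i\rho_G(P_i)$ over all layouts $\pi$. Active neighborhood-width: for $u\in P_i$ let $r_i^\pi(u)=N_G(u)\cap (V(G)\setminus P_i)$, let $\mathcal A_i^\pi=\{r_i^\pi(u):u\in P_i\}\setminus\{\emptyset\}$, and $\mathrm{anw}(G)=\min_\pi\max_i|\mathcal A_i^\pi|$ over all layouts $\pi$. -}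

module Defs where

open import Algebra.Bundles using (CommutativeRing)
open import Data.Bool using (Bool; true; false; _∧_; _∨_; not)
import Data.Bool.Properties as Bool
open import Data.Fin using (Fin; toℕ; _≟_)
open import Data.Fin.Permutation using (Permutation′; _⟨$⟩ˡ_)
open import Data.Fin.Properties using (all?)
open import Data.Fin.Subset
  using (Subset; _⊆_; ∁; ⁅_⁆; _∩_; _∪_; ∣_∣; Nonempty)
open import Data.Fin.Subset.Properties
  using (_∈?_; _⊆?_; nonempty?; anySubset?)
open import Data.List as List
  using (List; length; map; filter; deduplicate; allFin; upTo)
open import Data.List.Extrema.Nat using (max)
open import Data.Nat using (ℕ; zero; suc; _≤_; _∸_; _⊓_; _≡ᵇ_; ∣_-_∣; _<?_)
open import Data.Nat.Properties using (∣-∣-comm; ∣n-n∣≡0; ≤-antisym)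
open import Data.Product using (_×_; _,_; ∃)
open import Data.Vec as Vec using (lookup; tabulate)
open import Data.Vec.Properties using (≡-dec)
open import Relation.Binary.Definitions using (DecidableEquality)
open import Relation.Binary.PropositionalEquality
  using (_≡_; _≢_; refl; sym; cong; cong₂)
open import Relation.Nullary using (¬_; Dec; does; yes; no)
open import Relation.Nullary.Decidable
  using (¬?; _×-dec_; dec-true; dec-false; toWitness)

IsMinimum : {A : Set} → (A → ℕ) → ℕ → Set
IsMinimum f k = (∃ λ x → f x ≡ k) × (∀ x → k ≤ f x)

IsMinimum-unique : {A : Set} {f : A → ℕ} {k l : ℕ} →
                   IsMinimum f k → IsMinimum f l → k ≡ l
IsMinimum-unique ((x , refl) , k≤) ((y , refl) , l≤) = ≤-antisym (k≤ y) (l≤ x)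

-- The default value 0 is harmless: every maximum below is over a nonempty
-- list of natural numbers.
maximum : List ℕ → ℕ
maximum = max 0

subset-≟ : ∀ {n} → DecidableEquality (Subset n)
subset-≟ = ≡-dec Bool._≟_

allSubsets : ∀ n → List (Subset n)
allSubsets zero    = List.[ Vec.[] ]
allSubsets (suc n) = map (false Vec.∷_) (allSubsets n)
             List.++ map (true Vec.∷_) (allSubsets n)

elements : ∀ {n} → Subset n → List (Fin n)
elements {n} X = filter (_∈? X) (allFin n)

-- Matrices over 𝔽₂, which is Bool with _xor_ as addition and _∧_ as
-- multiplication

module 𝔽₂ = CommutativeRing Bool.xor-∧-commutativeRing

open import Algebra.Definitions.RawMonoid 𝔽₂.+-rawMonoid using (sum)

Matrix : ℕ → ℕ → Set
Matrix m k = Fin m → Fin k → Bool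

-- A vector of coefficients over 𝔽₂ is an element of Vec Bool m = Subset m;
-- it vanishes off S exactly when it is contained in S, and it is nonzero
-- exactly when it is nonempty.
Dependency : ∀ {m k} → Matrix m k → Subset m → Subset m → Set
Dependency M S c =
  c ⊆ S × Nonempty c × (∀ j → sum (λ i → lookup c i 𝔽₂.* M i j) ≡ 𝔽₂.0#)

IndependentRows : ∀ {m k} → Matrix m k → Subset m → Set
IndependentRows M S = ¬ ∃ (Dependency M S)

independentRows? : ∀ {m k} (M : Matrix m k) (S : Subset m) →
                   Dec (IndependentRows M S)
independentRows? M S = ¬? (anySubset? λ c →
  (c ⊆? S) ×-dec nonempty? c ×-dec
  all? (λ j → sum (λ i → lookup c i 𝔽₂.* M i j) Bool.≟ 𝔽₂.0#))

rank : ∀ {m k} → Matrix m k → ℕ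
rank {m} M = maximum (map ∣_∣ (filter (independentRows? M) (allSubsets m)))

record Graph (n : ℕ) : Set where
  field
    adj    : Fin n → Fin n → Bool
    symm   : ∀ u v → adj u v ≡ adj v u
    irrefl : ∀ u → adj u u ≡ false

open Graph public

N : ∀ {n} → Graph n → Fin n → Subset n
N G u = tabulate (adj G u)

N[_] : ∀ {n} → Graph n → Fin n → Subset n
N[ G ] u = ⁅ u ⁆ ∪ N G u

FalseTwins : ∀ {n} → Graph n → Fin n → Fin n → Set
FalseTwins G u v = u ≢ v × N G u ≡ N G v

TrueTwins : ∀ {n} → Graph n → Fin n → Fin n → Set
TrueTwins G u v = u ≢ v × N[ G ] u ≡ N[ G ] v

-- Layouts: π ⟨$⟩ʳ i is the vertex at position i (counted from 0), and
-- π ⟨$⟩ˡ v is the position of v.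

Layout : ℕ → Set
Layout = Permutation′

prefix : ∀ {n} → Layout n → ℕ → Subset n
prefix π i = tabulate λ v → does (toℕ (π ⟨$⟩ˡ v) <? i)

maxOverPrefixes : ∀ {n} → (Subset n → ℕ) → Layout n → ℕ
maxOverPrefixes {n} f π = maximum (map (λ i → f (prefix π i)) (upTo (suc n)))

cutMatrix : ∀ {n} → Graph n → (X : Subset n) →
            Matrix (length (elements X)) (length (elements (∁ X)))
cutMatrix G X i j =
  adj G (List.lookup (elements X) i) (List.lookup (elements (∁ X)) j)

cutrank : ∀ {n} → Graph n → Subset n → ℕ
cutrank G X = rank (cutMatrix G X)

IsLinearRankWidth : ∀ {n} → Graph n → ℕ → Set
IsLinearRankWidth G = IsMinimum (maxOverPrefixes (cutrank G))

activeNeighborhoods : ∀ {n} → Graph n → Subset n → List (Subset n)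
activeNeighborhoods G P =
  deduplicate subset-≟ (filter nonempty? (map (λ u → N G u ∩ ∁ P) (elements P)))

IsActiveNeighborhoodWidth : ∀ {n} → Graph n → ℕ → Set
IsActiveNeighborhoodWidth G =
  IsMinimum (maxOverPrefixes λ P → length (activeNeighborhoods G P))

complement : ∀ {n} → Graph n → Graph n
complement G .adj u v = not (does (u ≟ v)) ∧ not (adj G u v)
complement G .symm u v = cong₂ (λ a b → not a ∧ not b) (≟-sym u v) (symm G u v)
  where
  ≟-sym : ∀ {n} (x y : Fin n) → does (x ≟ y) ≡ does (y ≟ x)
  ≟-sym x y with x ≟ y
  ... | yes x≡y = sym (dec-true  (y ≟ x) (sym x≡y))
  ... | no  x≢y = sym (dec-false (y ≟ x) λ y≡x → x≢y (sym y≡x))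
complement G .irrefl u = cong (λ a → not a ∧ not (adj G u u)) (dec-true (u ≟ u) refl)

cyclicDistance : ∀ {n} → Fin n → Fin n → ℕ
cyclicDistance {n} u v = ∣ toℕ u - toℕ v ∣ ⊓ (n ∸ ∣ toℕ u - toℕ v ∣)

-- The usual cycle when n ≥ 3.
cycle : ∀ n → Graph n
cycle n .adj u v = cyclicDistance u v ≡ᵇ 1
cycle n .symm u v =
  cong (λ d → d ⊓ (n ∸ d) ≡ᵇ 1) (∣-∣-comm (toℕ u) (toℕ v))
cycle n .irrefl u =
  cong (λ d → d ⊓ (n ∸ d) ≡ᵇ 1) (∣n-n∣≡0 (toℕ u))

H : Graph 7
H = complement (cycle 7)

H-adj : ∀ u v → adj H u v ≡ (cyclicDistance u v ≡ᵇ 2) ∨ (cyclicDistance u v ≡ᵇ 3)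
H-adj = toWitness {a? = all? λ u → all? λ v → _ Bool.≟ _} _

{-# OPTIONS --safe #-}

-- The seven-vertex graph is checked by computation, but no enumeration of the
-- 7! layouts is needed: every layout has a prefix of each size k ≤ 7, so a
-- lower bound for all k-element vertex sets bounds the width of every layout.
-- Every 2-element set has cutrank at least 2, and every 3-element set induces
-- at least 3 active neighbourhoods.
module Submission where

open import Defs
open import Data.Bool using (Bool; true; false; if_then_else_)
open import Data.Fin using (Fin; zero; suc; toℕ; _≟_; #_)
open import Data.Fin.Permutation as Perm using (_⟨$⟩ˡ_; transpose)
open import Data.Fin.Properties using (all?)
open import Data.Fin.Subset using (Subset; ∣_∣)
open import Data.Fin.Subset.Properties using (anySubset?)
open import Data.List using (length)
open import Data.List.Extrema.Nat using (xs≤max)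
open import Data.List.Membership.Propositional using (_∈_)
open import Data.List.Membership.Propositional.Properties using (∈-map⁺; ∈-upTo⁺)
import Data.List.Relation.Unary.All as All
open import Data.Nat using (ℕ; zero; suc; _≤_; _<_; z≤n; s≤s; _<?_)
import Data.Nat as ℕ
open import Data.Nat.Properties using (+-0-commutativeMonoid; ≮⇒≥; ≤-trans)
open import Algebra.Properties.CommutativeMonoid.Sum +-0-commutativeMonoid
  using (sum; sum-permute)
open import Data.Product using (_×_; _,_; ∃)
open import Data.Vec using (tabulate)
open import Relation.Binary.PropositionalEquality
  using (_≡_; refl; cong; module ≡-Reasoning)
open import Relation.Nullary using (¬_; Dec; does)
open import Relation.Nullary.Decidable using (¬?; _×-dec_; False; from-yes; toWitnessFalse)

-- Recasts cardinality as a sum over `Fin n`, so that invariance of sums under permutation can be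
-- applied.
∣tabulate∣≡sum : ∀ {n} (f : Fin n → Bool) →
                 ∣ tabulate f ∣ ≡ sum (λ i → if f i then 1 else 0)
∣tabulate∣≡sum {zero}  f = refl
∣tabulate∣≡sum {suc n} f with f zero
... | true  = cong suc (∣tabulate∣≡sum λ i → f (suc i))
... | false = ∣tabulate∣≡sum λ i → f (suc i)

∣initial∣ : ∀ {n k} → k ≤ n → ∣ tabulate {n = n} (λ i → does (toℕ i <? k)) ∣ ≡ k
∣initial∣ {zero}  z≤n       = refl
∣initial∣ {suc n} z≤n       = ∣initial∣ {n} z≤n
∣initial∣ {suc n} (s≤s k≤n) = cong suc (∣initial∣ k≤n)

-- A prefix is the preimage of an initial segment under the position bijection, so reindexing
-- removes `π`.
∣prefix∣ : ∀ {n k} (π : Layout n) → k ≤ n → ∣ prefix π k ∣ ≡ k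
∣prefix∣ {n} {k} π k≤n = begin
  ∣ prefix π k ∣                        ≡⟨ ∣tabulate∣≡sum (λ v → initial (π ⟨$⟩ˡ v)) ⟩
  -- The forward map of `Perm.flip π` is the position map `π ⟨$⟩ˡ_`.
  sum (λ v → indicator (π ⟨$⟩ˡ v))      ≡⟨ sum-permute indicator (Perm.flip π) ⟨
  sum indicator                         ≡⟨ ∣tabulate∣≡sum initial ⟨
  ∣ tabulate initial ∣                  ≡⟨ ∣initial∣ k≤n ⟩
  k                                     ∎
  where
  open ≡-Reasoning

  initial : Fin n → Bool
  initial i = does (toℕ i <? k)

  indicator : Fin n → ℕ
  indicator i = if initial i then 1 else 0

∈⇒≤maximum : ∀ {x xs} → x ∈ xs → x ≤ maximum xs
∈⇒≤maximum {xs = xs} = All.lookup (xs≤max 0 xs)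

f[prefix]≤maxOverPrefixes : ∀ {n k} (f : Subset n → ℕ) (π : Layout n) → k ≤ n →
                            f (prefix π k) ≤ maxOverPrefixes f π
f[prefix]≤maxOverPrefixes f π k≤n =
  -- The prefix sizes range over `upTo (suc n)`, so `k = n` is included.
  ∈⇒≤maximum (∈-map⁺ (λ i → f (prefix π i)) (∈-upTo⁺ (s≤s k≤n)))

HasSmallSubset : ∀ {n} → (Subset n → ℕ) → ℕ → ℕ → Set
HasSmallSubset f k l = ∃ λ X → ∣ X ∣ ≡ k × f X < l

hasSmallSubset? : ∀ {n} (f : Subset n → ℕ) k l → Dec (HasSmallSubset f k l)
hasSmallSubset? f k l = anySubset? λ X → (∣ X ∣ ℕ.≟ k) ×-dec (f X <? l)

-- For closed arguments the search through all subsets evaluates; if it finds none, the `False`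
-- argument is the unit type and `_` fills it.
maxOverPrefixes-≥ : ∀ {n l} (f : Subset n → ℕ) k → k ≤ n →
                    False (hasSmallSubset? f k l) → ∀ π → l ≤ maxOverPrefixes f π
maxOverPrefixes-≥ f k k≤n none π = ≤-trans
  (≮⇒≥ λ f<l → toWitnessFalse none (prefix π k , ∣prefix∣ π k≤n , f<l))
  (f[prefix]≤maxOverPrefixes f π k≤n)

-- In the order 0, 1, …, 6 the prefix {0, 1, 2} has cutrank 3; 0, 1, 4, 3, 2, 5, 6 attains 2.
lrw-H : IsLinearRankWidth H 2
lrw-H = (transpose (# 2) (# 4) , refl) ,
        maxOverPrefixes-≥ (cutrank H) 2 (s≤s (s≤s z≤n)) _

anw-H : IsActiveNeighborhoodWidth H 3
anw-H = (Perm.id , refl) ,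
        -- Size 3 is the least that can work: `k` vertices induce at most `k` active neighbourhoods.
        maxOverPrefixes-≥ (λ P → length (activeNeighborhoods H P)) 3
          (s≤s (s≤s (s≤s z≤n))) _

twinFree-H : ∀ u v → ¬ FalseTwins H u v × ¬ TrueTwins H u v
twinFree-H = from-yes (all? λ u → all? λ v →
  ¬? (¬? (u ≟ v) ×-dec subset-≟ (N H u) (N H v)) ×-dec
  ¬? (¬? (u ≟ v) ×-dec subset-≟ (N[ H ] u) (N[ H ] v)))

lemma5p6 : IsLinearRankWidth H 2 × IsActiveNeighborhoodWidth H 3 ×
    (∀ u v → ¬ FalseTwins H u v × ¬ TrueTwins H u v)
lemma5p6 = lrw-H , anw-H , twinFree-H
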